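{- Let $n,k$ be integers with $1\le k\le \frac n2-1$, and let $T\in\mathcal T_{n,k}$. Then $$\prod\nolimits_1(T)\ \le\ 9^{k}4^{\,n-2k-2}=\left(\tfrac{9}{16}\right)^{k}4^{\,n-2},$$ and equality holds if and only if the degree sequence of $T$ is $$(\underbrace{3,\ldots,3}_{k},\underbrace{2,\ldots,2}_{n-2k-2},\underbrace{1,\ldots,1}_{k+2}).$$
   Context: All graphs are finite, simple, connected and undirected; $d(v)$ denotes the degree of a vertex $v$. $\mathcal T_{n,k}$ is the class of trees with $n$ vertices in which exactly $k$ vertices have degree equal to the maximum vertex degree of the tree. The first multiplicative Zagreb index of a graph $G$ is $\prod_1(G)=\prod_{u\in V(G)}d(u)^2$. The degree sequence of a graph is the list of its vertex degrees in non-increasing order. -}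

module Defs where

open import Data.Fin using (Fin)
open import Data.List using (List; []; _∷_; _∷ʳ_; allFin; filter; length; map)
open import Data.List.Extrema.Nat using (max)
open import Data.List.Relation.Unary.Linked using (Linked)
open import Data.List.Relation.Unary.Unique.Propositional using (Unique)
open import Data.Nat using (ℕ; _^_; _≤_; _≟_)
open import Data.Nat.ListAction using (product)
open import Data.Nat.Properties using (≤-decTotalOrder)
open import Data.Product using (_×_)
open import Data.Rational using (ℚ; +-*-rawSemiring)
open import Level using (0ℓ)
open import Relation.Binary.Core using (Rel)
open import Relation.Binary.Definitions using (Decidable; Irreflexive; Symmetric)
open import Relation.Binary.Construct.Closure.ReflexiveTransitive using (Star)
open import Relation.Binary.PropositionalEquality using (_≡_)
open import Relation.Nullary using (¬_)
import Relation.Binary.Construct.Flip.EqAndOrd as Flip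
import Data.List.Sort
import Algebra.Definitions.RawSemiring

-- Simple undirected graphs with vertex set Fin n.  Adjacency is asked to be
-- decidable, which classically is no restriction, so that degrees can be
-- computed.
record Graph (n : ℕ) : Set₁ where
  field
    Adj    : Rel (Fin n) 0ℓ
    adj?   : Decidable Adj
    symm   : Symmetric Adj
    irrefl : Irreflexive _≡_ Adj

open Graph public

module _ {n : ℕ} (G : Graph n) where

  Connected : Set
  Connected = ∀ u v → Star (Adj G) u v

  -- The list v₁, …, vₘ of vertices stands for the closed walk
  -- v₁, …, vₘ, v₁; it is a cycle if m ≥ 3 and the vᵢ are distinct.
  record IsCycle (v : Fin n) (vs : List (Fin n)) : Set where
    field
      length≥3 : 3 ≤ length (v ∷ vs)
      distinct : Unique (v ∷ vs)
      closed   : Linked (Adj G) ((v ∷ vs) ∷ʳ v)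

  Acyclic : Set
  Acyclic = ∀ v vs → ¬ IsCycle v vs

  record IsTree : Set where
    field
      connected : Connected
      acyclic   : Acyclic

  degree : Fin n → ℕ
  degree v = length (filter (adj? G v) (allFin n))

  degrees : List ℕ
  degrees = map degree (allFin n)

  -- The base value 0 matters only for the graph without vertices.
  maxDegree : ℕ
  maxDegree = max 0 degrees

  numMaxDegree : ℕ
  numMaxDegree = length (filter (λ v → degree v ≟ maxDegree) (allFin n))

  Π₁ : ℕ
  Π₁ = product (map (λ u → degree u ^ 2) (allFin n))

  -- Sorting is with respect to the reversed order _≥_, hence non-increasing.
  degreeSequence : List ℕ
  degreeSequence = sort degrees
    where open Data.List.Sort (Flip.decTotalOrder ≤-decTotalOrder) using (sort)

-- Membership of a graph on n vertices in the class 𝒯ₙ,ₖ.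
𝒯 : (n k : ℕ) → Graph n → Set
𝒯 n k G = IsTree G × numMaxDegree G ≡ k

infixr 8 _^ℚ_
_^ℚ_ : ℚ → ℕ → ℚ
_^ℚ_ = Algebra.Definitions.RawSemiring._^_ +-*-rawSemiring

{-# OPTIONS --safe #-}
module Submission where

-- Grow a tree from one vertex along edges to new vertices: each new vertex has
-- exactly one neighbour among the old ones, since two would close a cycle.
-- Thus the degree sum is 2(n − 1), that is, Σ (d − 1) = n − 2.  If the
-- maximum degree were at most 2, the k vertices of maximum degree would have
-- to account for this sum, contradicting 2k + 2 ≤ n; hence it is at least 3.
-- Now d ≤ 2^(d−1) for every d ≥ 1, and the sharper 4d ≤ 3 · 2^(d−1) holds for
-- d ≥ 3.  Using the latter exactly at the k vertices of maximum degree and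
-- multiplying, 4^k ∏ d ≤ 3^k 2^(n−2); its square is the bound.  Equality
-- forces all degrees to be at most 3, and then the numbers of vertices of
-- degree 2 and 1 are determined by n and the degree sum.

open import Defs
open import Algebra.Bundles using (CommutativeMonoid)
import Algebra.Properties.CommutativeSemigroup as CommutativeSemigroupProperties
open import Data.Fin using (Fin; zero; suc)
import Data.Fin.Properties as Fin
import Data.Integer.Properties as ℤ
open import Data.List using (List; []; _∷_; [_]; _++_; _∷ʳ_; allFin; filter; length; map; replicate; tabulate)
open import Data.List.Extrema.Nat using (max; max≤v⁺; xs≤max)
import Data.List.Membership.DecPropositional as DecMembership
open import Data.List.Membership.Propositional using (_∈_; _∉_; lose)
open import Data.List.Membership.Propositional.Properties using (∈-++⁻; ∈-++⁺ˡ; ∈-∃++; ∈-allFin)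
open import Data.List.Properties
  using (++-identityʳ; filter-++; filter-accept; filter-all; filter-none; filter-reject; filter-some;
         length-++; length-map; length-replicate; length-tabulate; map-cong)
open import Data.List.Relation.Binary.Permutation.Propositional
  using (_↭_; ↭-refl; ↭-sym; ↭-trans; ↭⇒↭ₛ; module PermutationReasoning)
open import Data.List.Relation.Binary.Permutation.Propositional.Properties
  using (All-resp-↭; ++⁺ˡ; filter-↭; map⁺; shift; ∈-resp-↭; ↭-length)
open import Data.List.Relation.Binary.Permutation.Setoid.Properties using (Unique-resp-↭)
open import Data.List.Relation.Unary.All as All using (All; []; _∷_)
import Data.List.Relation.Unary.All.Properties as Allₚ
open import Data.List.Relation.Unary.All.Properties using (++⁻ʳ; replicate⁺; ¬Any⇒All¬; ∷ʳ⁺)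
open import Data.List.Relation.Unary.AllPairs using (AllPairs; []; _∷_)
open import Data.List.Relation.Unary.Any using (here; there)
open import Data.List.Relation.Unary.Linked using (Linked; [-]; _∷_)
open import Data.List.Relation.Unary.Sorted.TotalOrder.Properties using (Sorted⇒AllPairs)
open import Data.List.Relation.Unary.Unique.Propositional using (Unique)
open import Data.List.Relation.Unary.Unique.Propositional.Properties using (Unique[x∷xs]⇒x∉xs; allFin⁺)
import Data.List.Sort
open import Data.Nat using (ℕ; zero; suc; pred; _+_; _*_; _∸_; _^_; _≤_; _≥_; _<_; z≤n; s≤s; _≟_)
open import Data.Nat.ListAction using (product; sum)
open import Data.Nat.ListAction.Properties using (product-++; product-↭; sum-++; sum-↭)
open import Data.Nat.Properties
open import Data.Nat.Tactic.RingSolver using (solve-∀)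
open import Data.Product using (_×_; _,_; ∃; ∃₂; ∃-syntax; proj₁; proj₂)
open import Data.Rational using (ℚ; _/_; fromℚᵘ; toℚᵘ) renaming (_*_ to _*ℚ_)
import Data.Rational.Properties as ℚ
import Data.Rational.Unnormalised as ℚᵘ
import Data.Rational.Unnormalised.Properties as ℚᵘ
open import Data.Sum using (inj₁; inj₂)
open import Function using (_∘_; id)
open import Function.Bundles using (Equivalence; _⇔_; mk⇔)
open import Level using (0ℓ)
open import Relation.Binary.Bundles using (DecTotalOrder)
open import Relation.Binary.Construct.Closure.ReflexiveTransitive using (Star; ε; _◅_)
import Relation.Binary.Construct.Flip.EqAndOrd as Flip
open import Relation.Binary.PropositionalEquality hiding ([_])
open import Relation.Nullary using (contradiction; no; yes)
open import Relation.Unary using (Decidable; Pred)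

open CommutativeSemigroupProperties *-commutativeSemigroup using () renaming (x∙yz≈y∙xz to *-swap)
open CommutativeSemigroupProperties +-commutativeSemigroup using () renaming (x∙yz≈y∙xz to +-swap)

-- Degree sums of induced subgraphs.

module _ {A : Set} {P : Pred A 0ℓ} (P? : Decidable P) where

  length-filter-unique : ∀ {x xs} → Unique xs → x ∈ xs → P x → (∀ {y} → y ∈ xs → P y → x ≡ y) →
                         length (filter P? xs) ≡ 1
  length-filter-unique {x} {y ∷ xs} (y≢ ∷ _) (here refl) px only with P? y
  ... | no ¬py = contradiction px ¬py
  ... | yes _  = cong (suc ∘ length) (filter-none P? (All.tabulate λ z∈ pz →
                   contradiction (only (there z∈) pz) (All.lookup y≢ z∈)))
  length-filter-unique {x} {y ∷ xs} (y≢ ∷ u) (there x∈) px only with P? y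
  ... | yes py = contradiction (sym (only (here refl) py)) (All.lookup y≢ x∈)
  ... | no _   = length-filter-unique u x∈ px (only ∘ there)

module _ {n : ℕ} (G : Graph n) where

  -- At `S = allFin n` this is `degree` by definition, so `degreeSumIn (allFin n)` is the full
  -- degree sum.
  neighboursIn : List (Fin n) → Fin n → ℕ
  neighboursIn S u = length (filter (adj? G u) S)

  degreeSumIn : List (Fin n) → ℕ
  degreeSumIn S = sum (map (neighboursIn S) S)

  -- Double counting: enlarging `S` by `w` adds one for each `u` adjacent to `w`, and by symmetry
  -- these are the neighbours of `w` in `us`. Keeping `us` apart from `S` lets the induction leave
  -- `S` fixed.
  neighboursIn-∷ : ∀ w S us → sum (map (neighboursIn (w ∷ S)) us) ≡
                   neighboursIn us w + sum (map (neighboursIn S) us)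
  neighboursIn-∷ w S []       = refl
  neighboursIn-∷ w S (u ∷ us) with adj? G u w | adj? G w u | neighboursIn-∷ w S us
  ... | yes _   | yes _   | ih = trans (cong (suc (neighboursIn S u) +_) ih)
    (lemma (neighboursIn S u) (neighboursIn us w) _)
    where
    lemma : ∀ a b c → suc a + (b + c) ≡ suc b + (a + c)
    lemma = solve-∀
  ... | yes u~w | no ¬w~u | _  = contradiction (symm G u~w) ¬w~u
  ... | no ¬u~w | yes w~u | _  = contradiction (symm G w~u) ¬u~w
  ... | no _    | no _    | ih = trans (cong (neighboursIn S u +_) ih)
    (lemma (neighboursIn S u) (neighboursIn us w) _)
    where
    lemma : ∀ a b c → a + (b + c) ≡ b + (a + c)
    lemma = solve-∀

  -- Each edge from `w` into `S` is counted once at either end, and there is no loop at `w`.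
  degreeSumIn-∷ : ∀ w S → degreeSumIn (w ∷ S) ≡ 2 * neighboursIn S w + degreeSumIn S
  degreeSumIn-∷ w S with adj? G w w
  ... | yes w~w = contradiction w~w (irrefl G refl)
  ... | no _    = trans (cong (neighboursIn S w +_) (neighboursIn-∷ w S S))
    (lemma (neighboursIn S w) (degreeSumIn S))
    where
    lemma : ∀ a b → a + (a + b) ≡ 2 * a + b
    lemma = solve-∀

  -- Simple paths, and connected vertex lists grown one edge at a time.

  data Path : Fin n → Fin n → List (Fin n) → Set where
    stop : ∀ {a} → Path a a [ a ]
    step : ∀ {a b c vs} → Adj G a c → All (a ≢_) vs → Path c b vs → Path a b (a ∷ vs)

  path-∷ʳ : ∀ {a b w vs} → Path a b vs → Adj G b w → All (w ≢_) vs → Path a w (vs ∷ʳ w)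
  path-∷ʳ stop          b~w (w≢b ∷ []) = step b~w ((w≢b ∘ sym) ∷ []) stop
  path-∷ʳ (step e a≢ p) b~w (w≢a ∷ w≢) = step e (∷ʳ⁺ a≢ (w≢a ∘ sym)) (path-∷ʳ p b~w w≢)

  path⇒unique : ∀ {a b vs} → Path a b vs → Unique vs
  path⇒unique stop          = [] ∷ []
  path⇒unique (step _ a≢ p) = a≢ ∷ path⇒unique p

  path⇒linked : ∀ {c a b w vs} → Adj G c a → Path a b vs → Adj G b w → Linked (Adj G) (c ∷ vs ∷ʳ w)
  path⇒linked c~a stop         b~w = c~a ∷ b~w ∷ [-]
  path⇒linked c~a (step e _ p) b~w = c~a ∷ path⇒linked e p b~w

  2≤length-path : ∀ {a b vs} → a ≢ b → Path a b vs → 2 ≤ length vs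
  2≤length-path a≢b stop                    = contradiction refl a≢b
  2≤length-path a≢b (step _ _ stop)         = s≤s (s≤s z≤n)
  2≤length-path a≢b (step _ _ (step _ _ _)) = s≤s (s≤s z≤n)

  -- The newest vertex stands first. Only some older neighbour is demanded; that it is the only one
  -- follows from acyclicity.
  data Grown : List (Fin n) → Set where
    root : ∀ r → Grown [ r ]
    add  : ∀ {w u S} → w ∉ S → u ∈ S → Adj G u w → Grown S → Grown (w ∷ S)

  grown⇒unique : ∀ {S} → Grown S → Unique S
  grown⇒unique (root _)       = [] ∷ []
  grown⇒unique (add w∉ _ _ g) = ¬Any⇒All¬ _ w∉ ∷ grown⇒unique g

  ∈⇒≢ : ∀ {w : Fin n} {S vs} → w ∉ S → All (_∈ S) vs → All (w ≢_) vs
  ∈⇒≢ w∉ = All.map λ { v∈ refl → w∉ v∈ }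

  -- The newest vertex `w` is attached to a path ending at its older neighbour `u`. That path stays
  -- within the older list, which is why this is part of the conclusion: it keeps `w` off the path,
  -- so the extension is again simple.
  grown⇒path : ∀ {S a b} → Grown S → a ∈ S → b ∈ S → ∃[ vs ] Path a b vs × All (_∈ S) vs
  grown⇒path (root r) (here refl) (here refl) = [ r ] , stop , here refl ∷ []
  grown⇒path (add {w} w∉ u∈ u~w g) (here refl) (here refl) = [ w ] , stop , here refl ∷ []
  grown⇒path (add {w} w∉ u∈ u~w g) (here refl) (there b∈) with grown⇒path g u∈ b∈
  ... | vs , p , vs∈ = w ∷ vs , step (symm G u~w) (∈⇒≢ w∉ vs∈) p , here refl ∷ All.map there vs∈
  grown⇒path (add {w} w∉ u∈ u~w g) (there a∈) (here refl) with grown⇒path g a∈ u∈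
  ... | vs , p , vs∈ = vs ∷ʳ w , path-∷ʳ p u~w (∈⇒≢ w∉ vs∈) , ∷ʳ⁺ (All.map there vs∈) (here refl)
  grown⇒path (add w∉ u∈ u~w g) (there a∈) (there b∈) with grown⇒path g a∈ b∈
  ... | vs , p , vs∈ = vs , p , All.map there vs∈

  -- Otherwise a path in `S` from `a` to `b` has at least two vertices and closes up through `w` to
  -- a cycle.
  acyclic⇒uniqueNeighbour : Acyclic G → ∀ {S w a b} → Grown S → w ∉ S → a ∈ S → b ∈ S →
                            Adj G w a → Adj G w b → a ≡ b
  acyclic⇒uniqueNeighbour acyclic {w = w} {a} {b} g w∉ a∈ b∈ w~a w~b with a Fin.≟ b
  ... | yes a≡b = a≡b
  ... | no a≢b  with grown⇒path g a∈ b∈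
  ...   | vs , p , vs∈ = contradiction
    (record { length≥3 = s≤s (2≤length-path a≢b p)
            ; distinct = ∈⇒≢ w∉ vs∈ ∷ path⇒unique p
            ; closed   = path⇒linked w~a p (symm G w~b) })
    (acyclic w vs)

  -- A new vertex brings exactly one edge, so both sides grow by 2. The summand 2 on the left avoids
  -- subtraction.
  degreeSumIn-grown : Acyclic G → ∀ {S} → Grown S → 2 + degreeSumIn S ≡ 2 * length S
  degreeSumIn-grown acyclic (root r) = cong (2 +_) (degreeSumIn-∷ r [])
  degreeSumIn-grown acyclic (add {w} {u} {S} w∉ u∈ u~w g) = begin
    2 + degreeSumIn (w ∷ S)                    ≡⟨ cong (2 +_) (degreeSumIn-∷ w S) ⟩
    2 + (2 * neighboursIn S w + degreeSumIn S) ≡⟨ cong (λ d → 2 + (2 * d + degreeSumIn S)) one ⟩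
    2 + (2 + degreeSumIn S)                    ≡⟨ cong (2 +_) (degreeSumIn-grown acyclic g) ⟩
    2 + 2 * length S                           ≡⟨ *-suc 2 (length S) ⟨
    2 * suc (length S)                         ∎
    where
    open ≡-Reasoning
    one : neighboursIn S w ≡ 1
    one = length-filter-unique (adj? G w) (grown⇒unique g) u∈ (symm G u~w)
            (λ v∈ w~v → acyclic⇒uniqueNeighbour acyclic g w∉ u∈ v∈ (symm G u~w) w~v)

  -- Growing to all vertices, and the degrees of a tree.

  open DecMembership (Fin._≟_ {n}) using (_∈?_)

  -- The first step of the walk that leaves `S`.
  crossingEdge : ∀ {S a b} → Star (Adj G) a b → a ∈ S → b ∉ S → ∃₂ λ u w → u ∈ S × w ∉ S × Adj G u w
  crossingEdge ε                 a∈ b∉ = contradiction a∈ b∉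
  crossingEdge {S} (_◅_ {j = c} a~c walk) a∈ b∉ with c ∈? S
  ... | yes c∈ = crossingEdge walk c∈ b∉
  ... | no c∉  = _ , c , a∈ , c∉ , a~c

  grown-nonempty : ∀ {S} → Grown S → ∃ (_∈ S)
  grown-nonempty (root r)          = r , here refl
  grown-nonempty (add {w} _ _ _ _) = w , here refl

  -- `R` holds the vertices not yet reached. The recursion runs on its length `m`, because the
  -- vertex `w` removed from `R` may sit anywhere in it.
  spanning : Connected G → ∀ m S R → length R ≡ m → Grown S → S ++ R ↭ allFin n →
             ∃[ S′ ] Grown S′ × S′ ↭ allFin n
  spanning connected zero    S []      _   g S↭ = S , g , subst (_↭ allFin n) (++-identityʳ S) S↭
  spanning connected (suc m) S (v ∷ R) len g S↭
    with r , r∈ ← grown-nonempty g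
    with u , w , u∈ , w∉ , u~w ← crossingEdge (connected r v) r∈
           -- `v` lies outside `S`, since `S ++ v ∷ R` rearranges the duplicate-free `allFin n`.
           (Unique[x∷xs]⇒x∉xs (Unique-resp-↭ (setoid _) (↭⇒↭ₛ (↭-trans (↭-sym S↭) (shift v S R))) (allFin⁺ n)) ∘ ∈-++⁺ˡ)
    with ∈-++⁻ S (∈-resp-↭ (↭-sym S↭) (∈-allFin w))
  ... | inj₁ w∈ = contradiction w∈ w∉
  ... | inj₂ w∈ with xs , ys , eq ← ∈-∃++ w∈ =
    spanning connected m (w ∷ S) (xs ++ ys)
      (suc-injective (trans (sym (↭-length (shift w xs ys))) (trans (cong length (sym eq)) len)))
      (add w∉ u∈ u~w g)
      (begin
        w ∷ S ++ xs ++ ys     ↭⟨ shift w S (xs ++ ys) ⟨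
        S ++ w ∷ xs ++ ys     ↭⟨ ++⁺ˡ S (↭-sym (shift w xs ys)) ⟩
        S ++ xs ++ w ∷ ys     ≡⟨ cong (S ++_) eq ⟨
        S ++ v ∷ R            ↭⟨ S↭ ⟩
        allFin n              ∎)
    where open PermutationReasoning

  degreeSumIn-↭ : ∀ {S S′} → S ↭ S′ → degreeSumIn S ≡ degreeSumIn S′
  degreeSumIn-↭ {S} {S′} S↭ = begin
    sum (map (neighboursIn S) S)   ≡⟨ cong sum (map-cong (λ u → ↭-length (filter-↭ (adj? G u) S↭)) S) ⟩
    sum (map (neighboursIn S′) S)  ≡⟨ sum-↭ (map⁺ (neighboursIn S′) S↭) ⟩
    sum (map (neighboursIn S′) S′) ∎
    where open ≡-Reasoning

tree-degreeSum : ∀ {n N} → n ≡ suc N → (T : Graph n) → IsTree T → sum (degrees T) ≡ 2 * N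
tree-degreeSum {N = n} refl T tree
  with S , g , S↭ ← spanning T (IsTree.connected tree) n [ zero ] (tabulate suc) (length-tabulate suc) (root zero) ↭-refl
  = +-cancelˡ-≡ 2 _ _ (begin
    2 + sum (degrees T)   ≡⟨ cong (2 +_) (degreeSumIn-↭ T S↭) ⟨
    2 + degreeSumIn T S   ≡⟨ degreeSumIn-grown T (IsTree.acyclic tree) g ⟩
    2 * length S          ≡⟨ cong (2 *_) (trans (↭-length S↭) (length-tabulate {n = suc n} id)) ⟩
    2 * suc n             ≡⟨ *-suc 2 n ⟩
    2 + 2 * n             ∎)
  where
  open ≡-Reasoning

-- The first edge of a walk to some other vertex supplies a neighbour.
connected⇒1≤degree : ∀ {n} → 2 ≤ n → (G : Graph n) → Connected G → ∀ v → 1 ≤ degree G v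
connected⇒1≤degree (s≤s (s≤s _)) G connected v = degree>0 v (proj₁ (other v)) (proj₂ (other v)) (connected v _)
  where
  other : ∀ v → ∃ (v ≢_)
  other zero    = suc zero , λ ()
  other (suc _) = zero , λ ()
  degree>0 : ∀ v w → v ≢ w → Star (Adj G) v w → 1 ≤ degree G v
  degree>0 v w v≢w ε         = contradiction refl v≢w
  degree>0 v w v≢w (e ◅ _) = filter-some (adj? G v) (lose (∈-allFin _) e)

-- Inequalities for products of positive integers, with equality cases.

count : ℕ → List ℕ → ℕ
count x ds = length (filter (_≟ x) ds)

count-accept : ∀ {d x} ds → d ≡ x → count x (d ∷ ds) ≡ suc (count x ds)
count-accept {x = x} ds d≡x = cong length (filter-accept (_≟ x) d≡x)

count-reject : ∀ {d x} ds → d ≢ x → count x (d ∷ ds) ≡ count x ds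
count-reject {x = x} ds d≢x = cong length (filter-reject (_≟ x) d≢x)

-- An inequality bundled with a consequence `X` of equality, so that bound and equality case go
-- through one induction.
_≤_withEquality_ : ℕ → ℕ → Set → Set
a ≤ b withEquality X = a ≤ b × (a ≡ b → X)

<⇒withEquality : ∀ {a b X} → a < b → a ≤ b withEquality X
<⇒withEquality a<b = <⇒≤ a<b , λ a≡b → contradiction a≡b (<⇒≢ a<b)

withEquality-map : ∀ {a b X Y} → (X → Y) → a ≤ b withEquality X → a ≤ b withEquality Y
withEquality-map f (a≤b , x) = a≤b , f ∘ x

-- Both factors must be equalities: compare through `a * d`, where positivity of `a` and `d` turns a
-- strict factor into a strict product.
*-withEquality : ∀ {a b c d X Y} → 0 < a → 0 < d → a ≤ b withEquality X → c ≤ d withEquality Y →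
                 (a * c) ≤ (b * d) withEquality (X × Y)
*-withEquality {suc a} {b} {c} {suc d} _ _ (a≤b , x) (c≤d , y) = *-mono-≤ a≤b c≤d , equal
  where
  equal : suc a * c ≡ b * suc d → _
  equal eq with m≤n⇒m<n∨m≡n a≤b | m≤n⇒m<n∨m≡n c≤d
  ... | inj₁ a<b | _ = contradiction eq (<⇒≢ (≤-<-trans (*-monoʳ-≤ (suc a) c≤d) (*-monoˡ-< (suc d) a<b)))
  ... | _ | inj₁ c<d = contradiction eq (<⇒≢ (<-≤-trans (*-monoʳ-< (suc a) c<d) (*-monoˡ-≤ (suc d) a≤b)))
  ... | inj₂ a≡b | inj₂ c≡d = x a≡b , y c≡d

-- This is 4d < 3 · 2^(d-1) for d = 4 + y. When d grows by 1, the right side doubles while the left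
-- gains only 4.
4*[4+y]<3*2^[3+y] : ∀ y → 4 * (4 + y) < 3 * 2 ^ (3 + y)
4*[4+y]<3*2^[3+y] zero    = m≤m+n 17 7
4*[4+y]<3*2^[3+y] (suc y) = begin-strict
  4 * (5 + y)                     ≡⟨ *-suc 4 (4 + y) ⟩
  4 + 4 * (4 + y)                 <⟨ +-mono-≤-< (≤-trans (m≤m*n 4 (4 + y)) (<⇒≤ ih)) ih ⟩
  3 * 2 ^ (3 + y) + 3 * 2 ^ (3 + y) ≡⟨ lemma (2 ^ (3 + y)) ⟩
  3 * 2 ^ (4 + y)                 ∎
  where
  open ≤-Reasoning
  ih = 4*[4+y]<3*2^[3+y] y
  lemma : ∀ q → 3 * q + 3 * q ≡ 3 * (2 * q)
  lemma = solve-∀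

-- Equality holds only for d = 1, 2; the weaker `d ≤ 3` is recorded to match the conclusion for
-- entries of maximum size.
d≤2^[d-1] : ∀ {d} → 1 ≤ d → d ≤ (2 ^ pred d) withEquality (d ≤ 3)
d≤2^[d-1] {1} _ = ≤-refl , λ _ → m≤m+n 1 2
d≤2^[d-1] {2} _ = ≤-refl , λ _ → m≤m+n 2 1
d≤2^[d-1] {3} _ = m≤m+n 3 1 , λ _ → ≤-refl
d≤2^[d-1] {suc (suc (suc (suc y)))} _ = <⇒withEquality (*-cancelˡ-< 4 _ _
  (<-≤-trans (4*[4+y]<3*2^[3+y] y) (*-monoˡ-≤ (2 ^ (3 + y)) (m≤m+n 3 1))))

4d≤3*2^[d-1] : ∀ {d} → 3 ≤ d → (4 * d) ≤ (3 * 2 ^ pred d) withEquality (d ≤ 3)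
4d≤3*2^[d-1] {1} (s≤s ())
4d≤3*2^[d-1] {2} (s≤s (s≤s ()))
4d≤3*2^[d-1] {3} _ = ≤-refl , λ _ → ≤-refl
4d≤3*2^[d-1] {suc (suc (suc (suc y)))} _ = <⇒withEquality (4*[4+y]<3*2^[3+y] y)

-- Each entry equal to `Δ` gains a factor 3/4 over d ≤ 2^(d-1); the powers of 4 on the left clear
-- the denominators.
product-bound : ∀ {Δ} → 3 ≤ Δ → ∀ ds → All (1 ≤_) ds →
                (4 ^ count Δ ds * product ds) ≤ (3 ^ count Δ ds * 2 ^ sum (map pred ds))
                withEquality All (_≤ 3) ds
product-bound 3≤Δ [] [] = ≤-refl , λ _ → []
product-bound {Δ} 3≤Δ (d ∷ ds) (1≤d ∷ 1≤ds)
  with d ≟ Δ | product-bound 3≤Δ ds 1≤ds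
... | yes d≡Δ | ih
  -- The rewrites regroup each side as a factor for `d` times the corresponding side for `ds`.
  rewrite count-accept ds d≡Δ
        | ^-distribˡ-+-* 2 (pred d) (sum (map pred ds))
        | [m*n]*[o*p]≡[m*o]*[n*p] 4 (4 ^ count Δ ds) d (product ds)
        | [m*n]*[o*p]≡[m*o]*[n*p] 3 (3 ^ count Δ ds) (2 ^ pred d) (2 ^ sum (map pred ds))
  = withEquality-map (λ (d≤3 , ds≤3) → d≤3 ∷ ds≤3)
      (*-withEquality (*-mono-< (s≤s (z≤n {3})) 1≤d) 0<bound
        (4d≤3*2^[d-1] (subst (3 ≤_) (sym d≡Δ) 3≤Δ)) ih)
  where
  0<bound = *-mono-< (m^n>0 3 (count Δ ds)) (m^n>0 2 (sum (map pred ds)))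
... | no d≢Δ | ih
  rewrite count-reject ds d≢Δ
        | ^-distribˡ-+-* 2 (pred d) (sum (map pred ds))
        | *-swap (4 ^ count Δ ds) d (product ds)
        | *-swap (3 ^ count Δ ds) (2 ^ pred d) (2 ^ sum (map pred ds))
  = withEquality-map (λ (d≤3 , ds≤3) → d≤3 ∷ ds≤3)
      (*-withEquality 1≤d 0<bound (d≤2^[d-1] 1≤d) ih)
  where
  0<bound = *-mono-< (m^n>0 3 (count Δ ds)) (m^n>0 2 (sum (map pred ds)))

-- An entry equal to `Δ` contributes at most 1 to the sum, and a smaller one is at most 1 and
-- contributes 0.
sum-pred≤count : ∀ {Δ} → Δ ≤ 2 → ∀ {ds} → All (_≤ Δ) ds → sum (map pred ds) ≤ count Δ ds
sum-pred≤count Δ≤2 [] = z≤n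
sum-pred≤count {Δ} Δ≤2 {d ∷ ds} (d≤Δ ∷ ds≤Δ) with d ≟ Δ | sum-pred≤count Δ≤2 ds≤Δ
... | yes d≡Δ | ih rewrite count-accept ds d≡Δ = +-mono-≤ (pred-mono-≤ (≤-trans d≤Δ Δ≤2)) ih
... | no d≢Δ  | ih rewrite count-reject ds d≢Δ = +-mono-≤ (pred-mono-≤ (≤-pred (≤-trans (≤∧≢⇒< d≤Δ d≢Δ) Δ≤2))) ih

sum-pred : ∀ {ds} → All (1 ≤_) ds → length ds + sum (map pred ds) ≡ sum ds
sum-pred []                       = refl
sum-pred {suc d ∷ ds} (_ ∷ 1≤ds) =
  cong suc (trans (+-swap (length ds) d _) (cong (d +_) (sum-pred 1≤ds)))

-- Non-increasing lists with entries 3, 2 and 1.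

leadingBlock : ∀ {m xs} → AllPairs _≥_ xs → All (_≤ suc m) xs → ∃₂ λ a ys →
               xs ≡ replicate a (suc m) ++ ys × AllPairs _≥_ ys × All (_≤ m) ys
leadingBlock [] [] = 0 , [] , refl , [] , []
leadingBlock {m} {x ∷ xs} (x≥ ∷ sorted) (x≤ ∷ xs≤) with m≤n⇒m<n∨m≡n x≤
... | inj₁ (s≤s x≤m) = 0 , x ∷ xs , refl , x≥ ∷ sorted , x≤m ∷ All.map (λ y≤x → ≤-trans y≤x x≤m) x≥
... | inj₂ refl with a , ys , refl , rest ← leadingBlock sorted xs≤ = suc a , ys , refl , rest

blocks : ℕ → ℕ → ℕ → List ℕ
blocks a b c = replicate a 3 ++ replicate b 2 ++ replicate c 1

-- Peel off the leading 3s, 2s and 1s; what remains has entries at most 0 and at least 1, so it is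
-- empty.
sorted⇒blocks : ∀ {xs} → AllPairs _≥_ xs → All (1 ≤_) xs → All (_≤ 3) xs →
                ∃₂ λ a b → ∃ λ c → xs ≡ blocks a b c
sorted⇒blocks sorted 1≤ ≤3
  with a , ys , refl , sorted , ≤2 ← leadingBlock sorted ≤3
  with b , zs , refl , sorted , ≤1 ← leadingBlock sorted ≤2
  with c , ws , refl , _ , ≤0 ← leadingBlock sorted ≤1
  with ws | ++⁻ʳ (replicate c 1) (++⁻ʳ (replicate b 2) (++⁻ʳ (replicate a 3) 1≤)) | ≤0
... | []    | []          | []        = a , b , c , cong (λ zs → replicate a 3 ++ replicate b 2 ++ zs) (++-identityʳ _)
... | _ ∷ _ | s≤s _ ∷ _   | () ∷ _

sum-replicate : ∀ n x → sum (replicate n x) ≡ n * x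
sum-replicate zero    x = refl
sum-replicate (suc n) x = cong (x +_) (sum-replicate n x)

product-replicate : ∀ n x → product (replicate n x) ≡ x ^ n
product-replicate zero    x = refl
product-replicate (suc n) x = cong (x *_) (product-replicate n x)

module _ (a b c : ℕ) where

  length-blocks : length (blocks a b c) ≡ a + (b + c)
  length-blocks = trans (length-++ (replicate a 3)) (cong₂ _+_ (length-replicate a)
    (trans (length-++ (replicate b 2)) (cong₂ _+_ (length-replicate b) (length-replicate c))))

  sum-blocks : sum (blocks a b c) ≡ a * 3 + (b * 2 + c * 1)
  sum-blocks = trans (sum-++ (replicate a 3) _) (cong₂ _+_ (sum-replicate a 3)
    (trans (sum-++ (replicate b 2) _) (cong₂ _+_ (sum-replicate b 2) (sum-replicate c 1))))

  product-blocks : product (blocks a b c) ≡ 3 ^ a * 2 ^ b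
  product-blocks = trans (product-++ (replicate a 3) _) (cong₂ _*_ (product-replicate a 3)
    (trans (product-++ (replicate b 2) _) (trans (cong₂ _*_ (product-replicate b 2)
      (trans (product-replicate c 1) (^-zeroˡ c))) (*-identityʳ _))))

  count3-blocks : count 3 (blocks a b c) ≡ a
  count3-blocks = begin
    length (filter (_≟ 3) (replicate a 3 ++ rest))                ≡⟨ cong length (filter-++ (_≟ 3) (replicate a 3) rest) ⟩
    length (filter (_≟ 3) (replicate a 3) ++ filter (_≟ 3) rest)  ≡⟨ cong₂ (λ xs ys → length (xs ++ ys))
                                                                       (filter-all (_≟ 3) (replicate⁺ a refl))
                                                                       (filter-none (_≟ 3) (Allₚ.++⁺ (replicate⁺ b λ ()) (replicate⁺ c λ ()))) ⟩
    length (replicate a 3 ++ [])                                  ≡⟨ cong length (++-identityʳ (replicate a 3)) ⟩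
    length (replicate a 3)                                        ≡⟨ length-replicate a ⟩
    a                                                             ∎
    where
    open ≡-Reasoning
    rest = replicate b 2 ++ replicate c 1

-- Subtracting the first equation from the second leaves 2a + b = 2a + m, which gives `b`; the first
-- then gives `c`. Subtraction is carried out by cancelling a common summand.
blockSizes : ∀ {a b c m} → a + (b + c) ≡ 2 + (2 * a + m) → a * 3 + (b * 2 + c * 1) ≡ 2 * suc (2 * a + m) →
             b ≡ m × c ≡ a + 2
blockSizes {a} {b} {c} {m} size total = b≡m , c≡a+2
  where
  open ≡-Reasoning
  b≡m : b ≡ m
  b≡m = +-cancelˡ-≡ (2 + (2 * a + m) + 2 * a) _ _ (begin
    2 + (2 * a + m) + 2 * a + b ≡⟨ cong (λ s → s + 2 * a + b) size ⟨
    a + (b + c) + 2 * a + b     ≡⟨ lhs a b c ⟩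
    a * 3 + (b * 2 + c * 1)     ≡⟨ total ⟩
    2 * suc (2 * a + m)         ≡⟨ rhs a m ⟩
    2 + (2 * a + m) + 2 * a + m ∎)
    where
    lhs : ∀ a b c → a + (b + c) + 2 * a + b ≡ a * 3 + (b * 2 + c * 1)
    lhs = solve-∀
    rhs : ∀ a m → 2 * suc (2 * a + m) ≡ 2 + (2 * a + m) + 2 * a + m
    rhs = solve-∀
  c≡a+2 : c ≡ a + 2
  c≡a+2 = +-cancelˡ-≡ (a + m) _ _ (begin
    a + m + c         ≡⟨ +-assoc a m c ⟩
    a + (m + c)       ≡⟨ cong (λ b → a + (b + c)) b≡m ⟨
    a + (b + c)       ≡⟨ size ⟩
    2 + (2 * a + m)   ≡⟨ rhs a m ⟩
    a + m + (a + 2)   ∎)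
    where
    rhs : ∀ a m → 2 + (2 * a + m) ≡ a + m + (a + 2)
    rhs = solve-∀

-- Lists with the length, sum and number of maximal entries of a tree's degree list; `m` stands for
-- n - 2k - 2.

≥-decTotalOrder : DecTotalOrder _ _ _
≥-decTotalOrder = Flip.decTotalOrder ≤-decTotalOrder

open Data.List.Sort ≥-decTotalOrder using (sort; sort-↭; sort-↗)

4^k≡2^2k : ∀ k → 4 ^ k ≡ 2 ^ (2 * k)
4^k≡2^2k = ^-*-assoc 2 2

module _ {ds k m} (1≤k : 1 ≤ k) (1≤ds : All (1 ≤_) ds) (size : length ds ≡ 2 + (2 * k + m))
         (total : sum ds ≡ 2 * suc (2 * k + m)) (top : count (max 0 ds) ds ≡ k) where

  sum-pred≡ : sum (map pred ds) ≡ 2 * k + m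
  sum-pred≡ = +-cancelˡ-≡ (length ds) _ _ (begin
    length ds + sum (map pred ds)    ≡⟨ sum-pred 1≤ds ⟩
    sum ds                           ≡⟨ total ⟩
    2 * suc (2 * k + m)              ≡⟨ lemma (2 * k + m) ⟩
    2 + (2 * k + m) + (2 * k + m)    ≡⟨ cong (_+ (2 * k + m)) size ⟨
    length ds + (2 * k + m)          ∎)
    where
    open ≡-Reasoning
    lemma : ∀ x → 2 * suc x ≡ 2 + x + x
    lemma = solve-∀

  -- With maximum at most 2, the sum 2k + m of all d - 1 would be at most `k`, but `1 ≤ k` gives k <
  -- 2k + m.
  3≤max : 3 ≤ max 0 ds
  3≤max = ≰⇒> λ max≤2 → <⇒≱ k<2k+m (begin
    2 * k + m            ≡⟨ sum-pred≡ ⟨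
    sum (map pred ds)    ≤⟨ sum-pred≤count max≤2 (xs≤max 0 ds) ⟩
    count (max 0 ds) ds  ≡⟨ top ⟩
    k                    ∎)
    where
    open ≤-Reasoning
    k<2k+m : k < 2 * k + m
    k<2k+m = ≤-trans (m<m+n k (≤-trans 1≤k (m≤m+n k 0))) (m≤m+n (2 * k) m)

  -- Since 3^k · 2^(2k+m) = 4^k · (3^k · 2^m), the factor 4^k cancels in `product-bound`.
  product≤ : product ds ≤ (3 ^ k * 2 ^ m) withEquality All (_≤ 3) ds
  product≤ with product-bound 3≤max ds 1≤ds
  ... | bound , eq rewrite top | sum-pred≡ | ^-distribˡ-+-* 2 (2 * k) m | sym (4^k≡2^2k k)
                         | *-swap (3 ^ k) (4 ^ k) (2 ^ m) =
    *-cancelˡ-≤ (4 ^ k) {{m^n≢0 4 k}} bound , eq ∘ cong (4 ^ k *_)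

  -- The maximum is squeezed to 3, so the number of 3s is `k`; length and sum then fix the other two
  -- blocks.
  sort≡blocks : All (_≤ 3) ds → sort ds ≡ blocks k m (k + 2)
  sort≡blocks ds≤3
    with a , b , c , eq ← sorted⇒blocks (Sorted⇒AllPairs (DecTotalOrder.totalOrder ≥-decTotalOrder) (sort-↗ ds))
           (All-resp-↭ (↭-sym (sort-↭ ds)) 1≤ds) (All-resp-↭ (↭-sym (sort-↭ ds)) ds≤3) =
    trans eq (blocks≡ a≡k)
    where
    max≡3 : max 0 ds ≡ 3
    max≡3 = ≤-antisym (max≤v⁺ z≤n ds≤3) 3≤max
    a≡k : a ≡ k
    a≡k = begin
      a                      ≡⟨ count3-blocks a b c ⟨
      count 3 (blocks a b c) ≡⟨ cong (count 3) eq ⟨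
      count 3 (sort ds)      ≡⟨ ↭-length (filter-↭ (_≟ 3) (sort-↭ ds)) ⟩
      count 3 ds             ≡⟨ cong (λ Δ → count Δ ds) max≡3 ⟨
      count (max 0 ds) ds    ≡⟨ top ⟩
      k                      ∎
      where open ≡-Reasoning
    blocks≡ : a ≡ k → blocks a b c ≡ blocks k m (k + 2)
    blocks≡ refl
      with refl , refl ← blockSizes {a} {b} {c} {m}
             (trans (sym (length-blocks a b c)) (trans (cong length (sym eq)) (trans (↭-length (sort-↭ ds)) size)))
             (trans (sym (sum-blocks a b c)) (trans (cong sum (sym eq)) (trans (sum-↭ (sort-↭ ds)) total)))
      = refl

  product-max⇔blocks : product ds ≡ 3 ^ k * 2 ^ m ⇔ sort ds ≡ blocks k m (k + 2)
  product-max⇔blocks = mk⇔ (sort≡blocks ∘ proj₂ product≤) (λ eq →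
    trans (sym (product-↭ (sort-↭ ds))) (trans (cong product eq) (product-blocks k m (k + 2))))

-- Counting vertices through degrees, squares, and the rational form of the bound.

module _ {A B : Set} {P : Pred B 0ℓ} (P? : Decidable P) (f : A → B) where

  length-filter-map : ∀ xs → length (filter P? (map f xs)) ≡ length (filter (P? ∘ f) xs)
  length-filter-map []       = refl
  length-filter-map (x ∷ xs) with P? (f x)
  ... | yes _ = cong suc (length-filter-map xs)
  ... | no _  = length-filter-map xs

^2-distrib-* : ∀ a b → (a * b) ^ 2 ≡ a ^ 2 * b ^ 2
^2-distrib-* = expanded
  where
  -- The solver does not interpret _^_ on ℕ, so the powers are unfolded.
  expanded : ∀ a b → (a * b) * ((a * b) * 1) ≡ (a * (a * 1)) * (b * (b * 1))
  expanded = solve-∀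

product-map-^2 : ∀ {A : Set} (f : A → ℕ) xs → product (map (λ x → f x ^ 2) xs) ≡ product (map f xs) ^ 2
product-map-^2 f []       = refl
product-map-^2 f (x ∷ xs) = trans (cong (f x ^ 2 *_) (product-map-^2 f xs)) (sym (^2-distrib-* (f x) (product (map f xs))))

^2-injective : ∀ {a b} → a ^ 2 ≡ b ^ 2 → a ≡ b
^2-injective {a} {b} eq = ≤-antisym (≮⇒≥ λ b<a → <⇒≢ (^-monoˡ-< 2 b<a) (sym eq))
                                    (≮⇒≥ λ a<b → <⇒≢ (^-monoˡ-< 2 a<b) eq)

9^k*4^m≡[3^k*2^m]^2 : ∀ k m → 9 ^ k * 4 ^ m ≡ (3 ^ k * 2 ^ m) ^ 2
9^k*4^m≡[3^k*2^m]^2 k m = begin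
  -- The bases 9 and 4 are `3 ^ 2` and `2 ^ 2` by computation.
  9 ^ k * 4 ^ m             ≡⟨ cong₂ _*_ (square 3 k) (square 2 m) ⟩
  (3 ^ k) ^ 2 * (2 ^ m) ^ 2 ≡⟨ ^2-distrib-* (3 ^ k) (2 ^ m) ⟨
  (3 ^ k * 2 ^ m) ^ 2       ∎
  where
  open ≡-Reasoning
  square : ∀ a k → (a ^ 2) ^ k ≡ (a ^ k) ^ 2
  square a k = trans (^-*-assoc a 2 k) (trans (cong (a ^_) (*-comm 2 k)) (sym (^-*-assoc a k 2)))

-- Imported only here, since +_ would make sections such as (x +_) ambiguous.
open import Data.Integer using (+_)

-- Since `_/_` reduces to lowest terms, the equation is checked on unnormalised rationals, where
-- products over denominator 1 compute.
/1-homo-* : ∀ a b → + (a * b) / 1 ≡ (+ a / 1) *ℚ (+ b / 1)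
/1-homo-* a b = ℚ.toℚᵘ-injective (begin
  toℚᵘ (fromℚᵘ ab)                         ≈⟨ ℚ.toℚᵘ-fromℚᵘ ab ⟩
  ab                                       ≡⟨ cong (λ z → ℚᵘ.mkℚᵘ z 0) (ℤ.pos-* a b) ⟩
  ι a ℚᵘ.* ι b                             ≈⟨ ℚᵘ.*-cong (ℚ.toℚᵘ-fromℚᵘ (ι a)) (ℚ.toℚᵘ-fromℚᵘ (ι b)) ⟨
  toℚᵘ (fromℚᵘ (ι a)) ℚᵘ.* toℚᵘ (fromℚᵘ (ι b)) ≈⟨ ℚ.toℚᵘ-homo-* (fromℚᵘ (ι a)) (fromℚᵘ (ι b)) ⟨
  toℚᵘ (fromℚᵘ (ι a) *ℚ fromℚᵘ (ι b))      ∎)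
  where
  open ℚᵘ.≃-Reasoning
  ι : ℕ → ℚᵘ.ℚᵘ
  ι x = ℚᵘ.mkℚᵘ (+ x) 0
  ab = ι (a * b)

/1-homo-^ : ∀ a m → + (a ^ m) / 1 ≡ (+ a / 1) ^ℚ m
/1-homo-^ a zero    = refl
/1-homo-^ a (suc m) = trans (/1-homo-* a (a ^ m)) (cong ((+ a / 1) *ℚ_) (/1-homo-^ a m))

-- Induction on `k`: raising `k` by one raises the exponent 2k + m = n - 2 of 4 by two.
bound-rational : ∀ k m → + (9 ^ k * 4 ^ m) / 1 ≡ (+ 9 / 16) ^ℚ k *ℚ (+ 4 / 1) ^ℚ (2 * k + m)
bound-rational zero    m = begin
  + (4 ^ m + 0) / 1                ≡⟨ cong (λ x → + x / 1) (+-identityʳ (4 ^ m)) ⟩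
  + (4 ^ m) / 1                    ≡⟨ /1-homo-^ 4 m ⟩
  (+ 4 / 1) ^ℚ m                   ≡⟨ ℚ.*-identityˡ _ ⟨
  (+ 1 / 1) *ℚ (+ 4 / 1) ^ℚ m      ∎
  where open ≡-Reasoning
bound-rational (suc k) m = begin
  + (9 * 9 ^ k * 4 ^ m) / 1                        ≡⟨ cong (λ x → + x / 1) (*-assoc 9 (9 ^ k) (4 ^ m)) ⟩
  + (9 * (9 ^ k * 4 ^ m)) / 1                      ≡⟨ /1-homo-* 9 (9 ^ k * 4 ^ m) ⟩
  -- The factorisations 9 = (9/16) · 16 and 16 = 4 · 4 hold by computation.
  (+ 9 / 1) *ℚ (+ (9 ^ k * 4 ^ m) / 1)             ≡⟨ cong ((+ 9 / 1) *ℚ_) (bound-rational k m) ⟩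
  ((+ 9 / 16) *ℚ (+ 16 / 1)) *ℚ (x ^ℚ k *ℚ y ^ℚ (2 * k + m))
    ≡⟨ *ℚ-interchange x (+ 16 / 1) (x ^ℚ k) _ ⟩
  x ^ℚ suc k *ℚ ((y *ℚ y) *ℚ y ^ℚ (2 * k + m))     ≡⟨ cong (x ^ℚ suc k *ℚ_) (ℚ.*-assoc y y (y ^ℚ (2 * k + m))) ⟩
  x ^ℚ suc k *ℚ y ^ℚ (2 + (2 * k + m))             ≡⟨ cong (λ e → x ^ℚ suc k *ℚ y ^ℚ (e + m)) (*-suc 2 k) ⟨
  x ^ℚ suc k *ℚ y ^ℚ (2 * suc k + m)               ∎
  where
  open ≡-Reasoning
  open CommutativeSemigroupProperties (CommutativeMonoid.commutativeSemigroup ℚ.*-1-commutativeMonoid)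
    using () renaming (interchange to *ℚ-interchange)
  x y : ℚ
  x = + 9 / 16
  y = + 4 / 1

-- The bound and its equality case for trees.

module _ {n k m} (n≡ : n ≡ 2 + (2 * k + m)) (1≤k : 1 ≤ k) (T : Graph n) (T∈𝒯 : 𝒯 n k T) where

  private
    tree = proj₁ T∈𝒯

    1≤degrees : All (1 ≤_) (degrees T)
    1≤degrees = Allₚ.map⁺ (All.universal (connected⇒1≤degree 2≤n T (IsTree.connected tree)) (allFin n))
      where
      2≤n : 2 ≤ n
      2≤n = subst (2 ≤_) (sym n≡) (m≤m+n 2 (2 * k + m))

    size : length (degrees T) ≡ 2 + (2 * k + m)
    size = trans (trans (length-map (degree T) (allFin n)) (length-tabulate {n = n} id)) n≡

    total : sum (degrees T) ≡ 2 * suc (2 * k + m)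
    total = tree-degreeSum n≡ T tree

    top : count (maxDegree T) (degrees T) ≡ k
    top = trans (length-filter-map (_≟ maxDegree T) (degree T) (allFin n)) (proj₂ T∈𝒯)

    Π₁≡ : Π₁ T ≡ product (degrees T) ^ 2
    Π₁≡ = product-map-^2 (degree T) (allFin n)

    maximal⇔blocks : product (degrees T) ≡ 3 ^ k * 2 ^ m ⇔ degreeSequence T ≡ blocks k m (k + 2)
    maximal⇔blocks = product-max⇔blocks 1≤k 1≤degrees size total top

  Π₁≤ : Π₁ T ≤ 9 ^ k * 4 ^ m
  Π₁≤ = subst₂ _≤_ (sym Π₁≡) (sym (9^k*4^m≡[3^k*2^m]^2 k m))
    (^-monoˡ-≤ 2 (proj₁ (product≤ 1≤k 1≤degrees size total top)))

  Π₁-max⇔blocks : Π₁ T ≡ 9 ^ k * 4 ^ m ⇔ degreeSequence T ≡ blocks k m (k + 2)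
  Π₁-max⇔blocks = mk⇔
    (λ eq → Equivalence.to maximal⇔blocks (^2-injective (trans (sym Π₁≡) (trans eq (9^k*4^m≡[3^k*2^m]^2 k m)))))
    (λ eq → trans Π₁≡ (trans (cong (_^ 2) (Equivalence.from maximal⇔blocks eq)) (sym (9^k*4^m≡[3^k*2^m]^2 k m))))

theorem3p2 : (n k : ℕ) → 1 ≤ k → 2 * k + 2 ≤ n →
    (T : Graph n) → 𝒯 n k T →
    (Π₁ T ≤ 9 ^ k * 4 ^ (n ∸ 2 * k ∸ 2))
    × (+ (9 ^ k * 4 ^ (n ∸ 2 * k ∸ 2)) / 1 ≡ (+ 9 / 16) ^ℚ k *ℚ (+ 4 / 1) ^ℚ (n ∸ 2))
    × (Π₁ T ≡ 9 ^ k * 4 ^ (n ∸ 2 * k ∸ 2)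
    ⇔ degreeSequence T ≡ replicate k 3 ++ replicate (n ∸ 2 * k ∸ 2) 2 ++ replicate (k + 2) 1)
theorem3p2 n k 1≤k 2k+2≤n T T∈𝒯 =
    Π₁≤ n≡ 1≤k T T∈𝒯
  , trans (bound-rational k m) (cong (λ e → (+ 9 / 16) ^ℚ k *ℚ (+ 4 / 1) ^ℚ e) (cong (_∸ 2) (sym n≡)))
  , Π₁-max⇔blocks n≡ 1≤k T T∈𝒯
  where
  m = n ∸ 2 * k ∸ 2
  -- By `2k+2≤n` the truncated subtractions in `m` are exact.
  n≡ : n ≡ 2 + (2 * k + m)
  n≡ = begin
    n                                 ≡⟨ m+[n∸m]≡n 2k+2≤n ⟨
    2 * k + 2 + (n ∸ (2 * k + 2))     ≡⟨ cong (λ j → 2 * k + 2 + j) (∸-+-assoc n (2 * k) 2) ⟨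
    2 * k + 2 + m                     ≡⟨ rearrange k m ⟩
    2 + (2 * k + m)                   ∎
    where
    open ≡-Reasoning
    rearrange : ∀ k m → 2 * k + 2 + m ≡ 2 + (2 * k + m)
    rearrange = solve-∀
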